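{- Let $G$ be a graph with maximum degree $\Delta$ and boxicity $b\ge 3$. Then $G$ contains an induced (chordless) cycle of length at least $\lfloor \log_{\Delta}(b-2)\rfloor+2$.
   Context: The boxicity of $G$ is the minimum $b$ such that $G$ is the intersection graph of axis-parallel boxes in $\mathbb{R}^b$ (products of $b$ closed intervals), one box per vertex. An induced cycle is a cycle in $G$ with no chord (no edge of $G$ joining two non-consecutive vertices of the cycle). -}

module Defs where

open import Data.Empty using (⊥)
open import Data.Fin using (Fin; toℕ)
open import Data.List using (length; filter; map; foldr; allFin)
open import Data.Nat using (ℕ; zero; suc; _≤_; _<_; _≤?_; _^_; _⊔_; z≤n; s≤s)
open import Data.Nat.Properties using (≤-refl; ≤-trans; <-≤-trans; ≤-<-trans; ≰⇒>; m≤n⇒m≤1+n; ^-monoˡ-≤; +-mono-≤; m≤m+n; m^n>0)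
open import Data.Product using (Σ; ∃-syntax; _×_)
open import Data.Rational using (ℚ) renaming (_<_ to _<ℚ_)
open import Data.Sum using (_⊎_)
open import Function.Bundles using (_⇔_)
open import Function.Definitions using (Injective)
open import Relation.Binary using (Symmetric; Irreflexive; Decidable)
open import Relation.Binary.PropositionalEquality using (_≡_; _≢_)
open import Relation.Nullary using (¬_; yes; no)

-- Real numbers as two-sided Dedekind cuts of ℚ.
record ℝ : Set₁ where
  field
    L U        : ℚ → Set
    inhabitedL : ∃[ q ] L q
    inhabitedU : ∃[ q ] U q
    roundedL   : ∀ p → L p ⇔ (∃[ q ] (p <ℚ q × L q))
    roundedU   : ∀ q → U q ⇔ (∃[ p ] (p <ℚ q × U p))
    disjoint   : ∀ q → L q → U q → ⊥
    located    : ∀ p q → p <ℚ q → L p ⊎ U q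

infix 4 _≤ℝ_
_≤ℝ_ : ℝ → ℝ → Set
x ≤ℝ y = ∀ q → ℝ.L x q → ℝ.L y q

record ClosedInterval : Set₁ where
  field
    lower upper : ℝ
    lower≤upper : lower ≤ℝ upper

Box : ℕ → Set₁
Box d = Fin d → ClosedInterval

_∈Box_ : ∀ {d} → (Fin d → ℝ) → Box d → Set
x ∈Box B = ∀ i → (ClosedInterval.lower (B i) ≤ℝ x i) × (x i ≤ℝ ClosedInterval.upper (B i))

Intersect : ∀ {d} → Box d → Box d → Set₁
Intersect {d} A B = Σ (Fin d → ℝ) λ x → (x ∈Box A) × (x ∈Box B)

record Graph (n : ℕ) : Set₁ where
  field
    Adj    : Fin n → Fin n → Set
    adj?   : Decidable Adj
    symm   : Symmetric Adj
    irrefl : Irreflexive _≡_ Adj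

open Graph public

degree : ∀ {n} → Graph n → Fin n → ℕ
degree {n} G v = length (filter (adj? G v) (allFin n))

maxDegree : ∀ {n} → Graph n → ℕ
maxDegree {n} G = foldr _⊔_ 0 (map (degree G) (allFin n))

record BoxRepresentation {n} (G : Graph n) (d : ℕ) : Set₁ where
  field
    box           : Fin n → Box d
    adj⇔intersect : ∀ u v → u ≢ v → Adj G u v ⇔ Intersect (box u) (box v)

record IsBoxicity {n} (G : Graph n) (b : ℕ) : Set₁ where
  field
    representation : BoxRepresentation G b
    minimal        : ∀ d → BoxRepresentation G d → b ≤ d

-- j is the cyclic successor of i among positions 0, …, ℓ - 1.
Next : ∀ {ℓ} → Fin ℓ → Fin ℓ → Set
Next {ℓ} i j = (suc (toℕ i) ≡ toℕ j) ⊎ ((suc (toℕ i) ≡ ℓ) × (toℕ j ≡ 0))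

record Cycle {n} (G : Graph n) (ℓ : ℕ) : Set where
  field
    ℓ≥3      : 3 ≤ ℓ
    vertex   : Fin ℓ → Fin n
    distinct : Injective _≡_ _≡_ vertex
    edge     : ∀ i j → Next i j → Adj G (vertex i) (vertex j)

Chordless : ∀ {n} {G : Graph n} {ℓ} → Cycle G ℓ → Set
Chordless {G = G} C = ∀ i j → ¬ Next i j → ¬ Next j i → ¬ Adj G (Cycle.vertex C i) (Cycle.vertex C j)

InducedCycle : ∀ {n} → Graph n → ℕ → Set
InducedCycle G ℓ = Σ (Cycle G ℓ) Chordless

greatestPower : (β x bound : ℕ) → ℕ
greatestPower β x zero = 0
greatestPower β x (suc k) with β ^ suc k ≤? x
... | yes _ = suc k
... | no  _ = greatestPower β x k

-- ⌊log_β x⌋: the greatest k with β ^ k ≤ x.  Such a k is below x, so the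
-- search bound x is no restriction, when β ≥ 2 and x ≥ 1 (^⌊log⌋≤ and
-- <^1+⌊log⌋ below); otherwise the logarithm is undefined and the value is junk.
⌊log[_]_⌋ : ℕ → ℕ → ℕ
⌊log[ β ] x ⌋ = greatestPower β x x

n<2^n : ∀ n → n < 2 ^ n
n<2^n zero    = s≤s z≤n
n<2^n (suc n) = +-mono-≤ (m^n>0 2 n) (≤-trans (n<2^n n) (m≤m+n (2 ^ n) 0))

^⌊log⌋≤ : ∀ β x → 1 ≤ x → β ^ ⌊log[ β ] x ⌋ ≤ x
^⌊log⌋≤ β x 1≤x = go x
  where
  go : ∀ k → β ^ greatestPower β x k ≤ x
  go zero = 1≤x
  go (suc k) with β ^ suc k ≤? x
  ... | yes p = p
  ... | no  _ = go k

<^1+⌊log⌋ : ∀ β x → 2 ≤ β → x < β ^ suc ⌊log[ β ] x ⌋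
<^1+⌊log⌋ β x 2≤β = go x (above ≤-refl)
  where
  above : ∀ {k} → x ≤ k → x < β ^ suc k
  above {k} x≤k = <-≤-trans (≤-<-trans (m≤n⇒m≤1+n x≤k) (n<2^n (suc k))) (^-monoˡ-≤ (suc k) 2≤β)
  go : ∀ k → x < β ^ suc k → x < β ^ suc (greatestPower β x k)
  go zero h = h
  go (suc k) h with β ^ suc k ≤? x
  ... | yes _ = h
  ... | no ¬p = go k (≰⇒> ¬p)

{-# OPTIONS --safe --termination-depth=2 #-}

-- An elimination forest is an ordered rooted forest on the vertices in which
-- adjacent vertices are comparable.  For a vertex v let B(v) be the set of strict
-- ancestors of v adjacent to a strict descendant of v.  If |B(v)| < c for all v,
-- colour greedily with c colours so that v differs from B(v); then G has boxicity
-- at most c + 1.  The subtree intervals of the preorder separate incomparable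
-- pairs.  In the dimension of colour k, a vertex v extends from the preorder
-- number of its ancestor neighbour of colour k (from its own number if there is
-- none) to its own number if v has colour k, and to infinity otherwise; with
-- k the colour of u this separates u from its non-adjacent descendants.
--
-- A graph without induced cycles has such a forest with all B(v) empty, hence
-- boxicity at most 2.  In general, search for the forest with a robber in S and
-- cops on N[P], for an induced path P with N(S) ⊆ N(P).  If every vertex of N(S)
-- dominated by an end of P is also dominated by another vertex of P, drop that
-- end; if P has fewer than m vertices, extend it by a vertex of N(S); otherwise S
-- is disconnected, or an induced path through S closes P to an induced cycle of
-- length at least m + 2.  So |B(v)| < max(m Δ, Δ + 1) if there is no such cycle,
-- and m Δ ≤ Δ ^ m for Δ ≥ 2.
module Submission where

open import Data.Empty using (⊥; ⊥-elim)
open import Data.Fin using (Fin; toℕ; zero; suc) renaming (_≟_ to _≟ᶠ_; fromℕ to lastFin)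
open import Data.Fin.Properties using (any?; injective⇒≤; toℕ-injective; toℕ-fromℕ)
open import Data.Fin.Subset using (Subset; _∈_; _∉_; _⊆_; _⊂_; _─_; _-_; Empty; ⁅_⁆; inside; outside) renaming (⊤ to full)
open import Data.Fin.Subset.Induction using (⊂-wellFounded)
open import Data.Fin.Subset.Properties using (_∈?_; x∈⁅x⁆; p─q⊆p; x∈p∧x∉q⇒x∈p─q; x∈p∧x≢y⇒x∈p-y; x∈p⇒p-x⊂p; ∈⊤)
import Data.Integer as ℤ
import Data.Integer.Properties as ℤ
open import Data.List using (List; []; _∷_; length; map; filter; allFin; concatMap; lookup; foldr; _++_)
open import Data.List.Properties using (length-map; length-++; filter-notAll)
import Data.List.Membership.DecPropositional as DecMembership
open import Data.List.Membership.Propositional using (lose; find) renaming (_∈_ to _∈ˡ_; _∉_ to _∉ˡ_)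
open import Data.List.Membership.Propositional.Properties using (∈-map⁺; ∈-lookup; ∈-filter⁺; ∈-filter⁻; ∈-allFin; ∈-concatMap⁺; ∈-concatMap⁻; ∈-++⁻)
import Data.List.Membership.Setoid.Properties as SetoidMembership
open import Data.List.Relation.Unary.All as All using (All)
open import Data.List.Relation.Unary.All.Properties using (¬Any⇒All¬)
open import Data.List.Relation.Unary.Any as Any using (Any; here; there)
open import Data.List.Relation.Unary.Any.Properties using (¬Any[])
open import Data.Nat using (ℕ; zero; suc; _+_; _*_; _∸_; _^_; _⊔_; _≤_; _<_; z≤n; s≤s; _<?_; _≤?_)
open import Data.Nat.Coprimality using (1-coprimeTo) renaming (sym to coprime-sym)
open import Data.Nat.Properties
open import Data.Product using (∃; ∃-syntax; _×_; _,_; proj₁; proj₂)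
open import Data.Rational using (ℚ; mkℚ; *<*) renaming (_<_ to _<ℚ_)
import Data.Rational.Properties as ℚ
open import Data.Sum using (_⊎_; inj₁; inj₂; [_,_]′; map₁; map₂)
open import Data.Vec using (_∷_; here; there)
open import Function.Base using (_∘_)
open import Function.Bundles using (mk⇔)
open import Induction.WellFounded using (Acc; acc)
open import Relation.Binary.Definitions using (tri<; tri≈; tri>)
open import Relation.Binary.PropositionalEquality using (_≡_; _≢_; refl; sym; trans; cong; subst; subst₂; setoid)
open import Relation.Nullary using (¬_; Dec; yes; no; ¬?; _×-dec_; _⊎-dec_; decidable-stable)
open import Defs

-- Natural numbers as Dedekind reals.

fromℕ : ℕ → ℚ
fromℕ k = mkℚ (ℤ.+ k) 0 (coprime-sym (1-coprimeTo k))

fromℕ-mono-< : ∀ {k l} → k < l → fromℕ k <ℚ fromℕ l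
fromℕ-mono-< k<l = *<* (subst₂ ℤ._<_ (sym (ℤ.*-identityʳ _)) (sym (ℤ.*-identityʳ _)) (ℤ.+<+ k<l))

fromℕ-mono-≤ : ∀ {k l q} → k ≤ l → q <ℚ fromℕ k → q <ℚ fromℕ l
fromℕ-mono-≤ k≤l q<k with m≤n⇒m<n∨m≡n k≤l
... | inj₁ k<l  = ℚ.<-trans q<k (fromℕ-mono-< k<l)
... | inj₂ refl = q<k

real : ℕ → ℝ
real k = record
  { L          = _<ℚ fromℕ k
  ; U          = fromℕ k <ℚ_
  ; inhabitedL = mkℚ ℤ.-[1+ 0 ] 0 (1-coprimeTo 1) , *<* (subst (ℤ.-[1+ 0 ] ℤ.<_) (sym (ℤ.*-identityʳ (ℤ.+ k))) ℤ.-<+)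
  ; inhabitedU = fromℕ (suc k) , fromℕ-mono-< (n<1+n k)
  ; roundedL   = λ p → mk⇔ ℚ.<-dense λ (q , p<q , q<k) → ℚ.<-trans p<q q<k
  ; roundedU   = λ q → mk⇔ (λ k<q → let p , k<p , p<q = ℚ.<-dense k<q in p , p<q , k<p)
                           λ (p , p<q , k<p) → ℚ.<-trans k<p p<q
  ; disjoint   = λ q q<k k<q → ℚ.<-asym q<k k<q
  ; located    = located
  }
  where
  located : ∀ p q → p <ℚ q → p <ℚ fromℕ k ⊎ fromℕ k <ℚ q
  located p q p<q with p ℚ.<? fromℕ k
  ... | yes p<k = inj₁ p<k
  ... | no  p≮k = inj₂ (ℚ.≤-<-trans (ℚ.≮⇒≥ p≮k) p<q)

real-mono : ∀ {k l} → k ≤ l → real k ≤ℝ real l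
real-mono k≤l _ = fromℕ-mono-≤ k≤l

real-cancel : ∀ {k l} → real k ≤ℝ real l → k ≤ l
real-cancel {k} {l} k≤l = ≮⇒≥ λ l<k → ℚ.<-irrefl refl (k≤l (fromℕ l) (fromℕ-mono-< l<k))

-- Subsets, fresh colours, pointwise updates.

x∈p─q⇒x∉q : ∀ {n} {p q : Subset n} {x} → x ∈ p ─ q → x ∉ q
x∈p─q⇒x∉q {p = inside ∷ _} {outside ∷ _} here      ()
x∈p─q⇒x∉q {p = _ ∷ _}      {_ ∷ _}       (there m) (there k) = x∈p─q⇒x∉q m k

x∉p-x : ∀ {n} {p : Subset n} {x} → x ∉ p - x
x∉p-x m = x∈p─q⇒x∉q m (x∈⁅x⁆ _)

-- Pigeonhole: if every colour occurred in `l`, positions would inject `Fin c` into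
-- `Fin (length l)`.
fresh : ∀ {c} (l : List (Fin c)) → length l < c → ∃[ k ] k ∉ˡ l
fresh l l<c with any? (λ k → ¬? (DecMembership._∈?_ _≟ᶠ_ k l))
... | yes found = found
... | no ¬found = ⊥-elim (<⇒≱ l<c (injective⇒≤ λ {i} {j} → SetoidMembership.index-injective (setoid _) (all∈ i) (all∈ j)))
  where
  all∈ : ∀ k → k ∈ˡ l
  all∈ k = decidable-stable (DecMembership._∈?_ _≟ᶠ_ k l) λ k∉ → ¬found (k , k∉)

updated : ∀ {n} {A : Set} → Fin n → A → (Fin n → A) → Fin n → A
updated v l f x with x ≟ᶠ v
... | yes _ = l
... | no  _ = f x

updated-at : ∀ {n} {A : Set} (v : Fin n) (l : A) f → updated v l f v ≡ l
updated-at v l f with v ≟ᶠ v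
... | yes _  = refl
... | no v≢v = ⊥-elim (v≢v refl)

updated-off : ∀ {n} {A : Set} {v x : Fin n} (l : A) f → x ≢ v → updated v l f x ≡ f x
updated-off {v = v} {x} l f x≢v with x ≟ᶠ v
... | yes x≡v = ⊥-elim (x≢v x≡v)
... | no  _   = refl

module _ {n} (G : Graph n) where

  -- Boxes with natural end points.

  -- In each coordinate the larger left end is a common point. `meet` is asked in one direction
  -- only, since adjacency is symmetric.
  fromIntervals : ∀ {d} (lo hi : Fin d → Fin n → ℕ) → (∀ i v → lo i v ≤ hi i v) →
                  (∀ {u v} → Adj G u v → ∀ i → lo i u ≤ hi i v) →
                  (∀ {u v} → u ≢ v → ¬ Adj G u v → ∃[ i ] (hi i u < lo i v ⊎ hi i v < lo i u)) →
                  BoxRepresentation G d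
  fromIntervals lo hi lo≤hi meet separate = record
    { box           = box
    ; adj⇔intersect = λ u v u≢v → mk⇔ intersect (adjacent u≢v)
    }
    where
    box : Fin n → Box _
    box v i = record { lower = real (lo i v) ; upper = real (hi i v) ; lower≤upper = real-mono (lo≤hi i v) }

    intersect : ∀ {u v} → Adj G u v → Intersect (box u) (box v)
    intersect {u} {v} uv =
      (λ i → real (lo i u ⊔ lo i v)) ,
      (λ i → real-mono (m≤m⊔n _ _) , real-mono (⊔-lub (lo≤hi i u) (meet (symm G uv) i))) ,
      (λ i → real-mono (m≤n⊔m _ _) , real-mono (⊔-lub (meet uv i) (lo≤hi i v)))

    adjacent : ∀ {u v} → u ≢ v → Intersect (box u) (box v) → Adj G u v
    adjacent {u} {v} u≢v (x , x∈u , x∈v) with adj? G u v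
    ... | yes uv = uv
    ... | no ¬uv with separate u≢v ¬uv
    ...   | i , inj₁ u<v = ⊥-elim (<⇒≱ u<v (real-cancel λ q l → proj₂ (x∈u i) q (proj₁ (x∈v i) q l)))
    ...   | i , inj₂ v<u = ⊥-elim (<⇒≱ v<u (real-cancel λ q l → proj₂ (x∈v i) q (proj₁ (x∈u i) q l)))

  -- Elimination forests and their preorder layouts.

  -- An elimination forest for G[S]: root makes v the ancestor of all of S - v,
  -- so the vertices outside S with a neighbour in S - v are ancestors of v, and
  -- the bag collects them.
  data Elim (c : ℕ) : Subset n → Set where
    empty : ∀ {S} → Empty S → Elim c S
    root  : ∀ {S} v → v ∈ S → (bag : List (Fin n)) → length bag < c →
            (∀ {a x} → a ∉ S → x ∈ S → x ≢ v → Adj G a x → a ∈ˡ bag) →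
            Elim c (S - v) → Elim c S
    split : ∀ {S} U → U ⊆ S → (∀ {a x} → a ∈ S ─ U → x ∈ U → ¬ Adj G a x) →
            Elim c (S ─ U) → Elim c U → Elim c S

  -- pre is the preorder number, and [pre, end] contains the preorder numbers of
  -- the subtree.
  record Label (c : ℕ) : Set where
    constructor label
    field
      pre end : ℕ
      col     : Fin c

  open Label

  record Layout {c} (S : Subset n) (lab : Fin n → Label c) (s t : ℕ) : Set where
    field
      s≤pre    : ∀ {x} → x ∈ S → s ≤ pre (lab x)
      pre≤end  : ∀ {x} → x ∈ S → pre (lab x) ≤ end (lab x)
      end<t    : ∀ {x} → x ∈ S → end (lab x) < t
      pre-inj  : ∀ {x y} → x ∈ S → y ∈ S → pre (lab x) ≡ pre (lab y) → x ≡ y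
      nested   : ∀ {u v} → u ∈ S → v ∈ S → Adj G u v → pre (lab u) ≤ pre (lab v) → pre (lab v) ≤ end (lab u)
      -- A vertex a outside S counts as preceding all of S.
      coloured : ∀ {a u v} → u ∈ S → v ∈ S → (a ∈ S → pre (lab a) < pre (lab u)) →
                 pre (lab u) < pre (lab v) → pre (lab v) ≤ end (lab u) → Adj G a v → col (lab u) ≢ col (lab a)

  -- `coloured` also reads colours outside `S`, but only of neighbours of `S`. So `U` may be
  -- relabelled after `S ─ U` has been laid out.
  Layout-resp : ∀ {c} {S} {lab lab′ : Fin n → Label c} {s t} → (∀ {x} → x ∈ S → lab x ≡ lab′ x) →
                (∀ {a x} → x ∈ S → Adj G a x → lab a ≡ lab′ a) → Layout S lab s t → Layout S lab′ s t
  Layout-resp {lab = lab} {lab′} {s} {t} eq eqᴺ ℓ = record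
    { s≤pre    = λ x∈ → subst (λ l → s ≤ pre l) (eq x∈) (s≤pre x∈)
    ; pre≤end  = λ x∈ → subst (λ l → pre l ≤ end l) (eq x∈) (pre≤end x∈)
    ; end<t    = λ x∈ → subst (λ l → end l < t) (eq x∈) (end<t x∈)
    ; pre-inj  = λ x∈ y∈ e → pre-inj x∈ y∈ (trans (cong pre (eq x∈)) (trans e (cong pre (sym (eq y∈)))))
    ; nested   = λ u∈ v∈ uv → subst₂ (λ k l → pre k ≤ pre l → pre l ≤ end k) (eq u∈) (eq v∈) (nested u∈ v∈ uv)
    ; coloured = λ {a} {u} {v} u∈ v∈ a<u u<v v≤u av → coloured′ (eq u∈) (eq v∈) (eqᴺ v∈ av) u∈ v∈ a<u u<v v≤u av
    }
    where
    open Layout ℓ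
    coloured′ : ∀ {a u v} → lab u ≡ lab′ u → lab v ≡ lab′ v → lab a ≡ lab′ a → u ∈ _ → v ∈ _ →
                (a ∈ _ → pre (lab′ a) < pre (lab′ u)) → pre (lab′ u) < pre (lab′ v) →
                pre (lab′ v) ≤ end (lab′ u) → Adj G a v → col (lab′ u) ≢ col (lab′ a)
    coloured′ eu ev ea rewrite sym eu | sym ev | sym ea = coloured

  -- The numbers of `U` come after all intervals of `S ─ U`. So mixed pairs are never nested, and
  -- being non-adjacent they need not be.
  Layout-split : ∀ {c} {S U} {lab : Fin n → Label c} {s t t′} → U ⊆ S →
                 (∀ {a x} → a ∈ S ─ U → x ∈ U → ¬ Adj G a x) → s ≤ t → t ≤ t′ →
                 Layout (S ─ U) lab s t → Layout U lab t t′ → Layout S lab s t′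
  Layout-split {c} {S} {U} {lab} {s} {t} {t′} U⊆S no-edge s≤t t≤t′ ℓ₁ ℓ₂ = record
    { s≤pre    = λ x∈ → [ L₁.s≤pre , ≤-trans s≤t ∘ L₂.s≤pre ]′ (side x∈)
    ; pre≤end  = λ x∈ → [ L₁.pre≤end , L₂.pre≤end ]′ (side x∈)
    ; end<t    = λ x∈ → [ (λ m → <-≤-trans (L₁.end<t m) t≤t′) , L₂.end<t ]′ (side x∈)
    ; pre-inj  = pre-inj
    ; nested   = nested
    ; coloured = coloured
    }
    where
    module L₁ = Layout ℓ₁
    module L₂ = Layout ℓ₂

    side : ∀ {x} → x ∈ S → x ∈ S ─ U ⊎ x ∈ U
    side {x} x∈S with x ∈? U
    ... | yes x∈U = inj₂ x∈U
    ... | no  x∉U = inj₁ (x∈p∧x∉q⇒x∈p─q x∈S x∉U)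

    end<pre : ∀ {x y} → x ∈ S ─ U → y ∈ U → end (lab x) < pre (lab y)
    end<pre x∈ y∈ = <-≤-trans (L₁.end<t x∈) (L₂.s≤pre y∈)

    pre<pre : ∀ {x y} → x ∈ S ─ U → y ∈ U → pre (lab x) < pre (lab y)
    pre<pre x∈ y∈ = ≤-<-trans (L₁.pre≤end x∈) (end<pre x∈ y∈)

    pre-inj : ∀ {x y} → x ∈ S → y ∈ S → pre (lab x) ≡ pre (lab y) → x ≡ y
    pre-inj x∈ y∈ e with side x∈ | side y∈
    ... | inj₁ p | inj₁ q = L₁.pre-inj p q e
    ... | inj₁ p | inj₂ q = ⊥-elim (<⇒≢ (pre<pre p q) e)
    ... | inj₂ p | inj₁ q = ⊥-elim (<⇒≢ (pre<pre q p) (sym e))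
    ... | inj₂ p | inj₂ q = L₂.pre-inj p q e

    nested : ∀ {u v} → u ∈ S → v ∈ S → Adj G u v → pre (lab u) ≤ pre (lab v) → pre (lab v) ≤ end (lab u)
    nested u∈ v∈ uv with side u∈ | side v∈
    ... | inj₁ p | inj₁ q = L₁.nested p q uv
    ... | inj₁ p | inj₂ q = ⊥-elim (no-edge p q uv)
    ... | inj₂ p | inj₁ q = ⊥-elim (no-edge q p (symm G uv))
    ... | inj₂ p | inj₂ q = L₂.nested p q uv

    coloured : ∀ {a u v} → u ∈ S → v ∈ S → (a ∈ S → pre (lab a) < pre (lab u)) →
               pre (lab u) < pre (lab v) → pre (lab v) ≤ end (lab u) → Adj G a v → col (lab u) ≢ col (lab a)
    coloured u∈ v∈ a<u u<v v≤u with side u∈ | side v∈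
    ... | inj₁ p | inj₁ q = L₁.coloured p q (a<u ∘ p─q⊆p S U) u<v v≤u
    ... | inj₁ p | inj₂ q = ⊥-elim (<⇒≱ (end<pre p q) v≤u)
    ... | inj₂ p | inj₁ q = ⊥-elim (<-asym u<v (pre<pre q p))
    ... | inj₂ p | inj₂ q = L₂.coloured p q (a<u ∘ U⊆S) u<v v≤u

  -- The new case of `coloured` is `u = v`. No vertex of `S` has a number below `s`, so there `a`
  -- lies outside `S`.
  Layout-root : ∀ {c} {S v} {lab : Fin n → Label c} {s t} →
                pre (lab v) ≡ s → end (lab v) ≡ t → s < t →
                (∀ {a x} → a ∉ S → x ∈ S → x ≢ v → Adj G a x → col (lab v) ≢ col (lab a)) →
                Layout (S - v) lab (suc s) t → Layout S lab s (suc t)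
  Layout-root {c} {S} {v} {lab} {s} {t} refl refl s<t new ℓ = record
    { s≤pre    = λ x∈ → [ (λ { refl → ≤-refl }) , <⇒≤ ∘ s≤pre ]′ (view x∈)
    ; pre≤end  = λ x∈ → [ (λ { refl → <⇒≤ s<t }) , pre≤end ]′ (view x∈)
    ; end<t    = λ x∈ → [ (λ { refl → ≤-refl }) , m≤n⇒m≤1+n ∘ end<t ]′ (view x∈)
    ; pre-inj  = pre-inj′
    ; nested   = nested′
    ; coloured = coloured′
    }
    where
    open Layout ℓ

    view : ∀ {x} → x ∈ S → x ≡ v ⊎ x ∈ S - v
    view {x} x∈S with x ≟ᶠ v
    ... | yes x≡v = inj₁ x≡v
    ... | no  x≢v = inj₂ (x∈p∧x≢y⇒x∈p-y x∈S x≢v)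

    pre-inj′ : ∀ {x y} → x ∈ S → y ∈ S → pre (lab x) ≡ pre (lab y) → x ≡ y
    pre-inj′ x∈ y∈ e with view x∈ | view y∈
    ... | inj₁ refl | inj₁ refl = refl
    ... | inj₁ refl | inj₂ q    = ⊥-elim (<⇒≢ (s≤pre q) e)
    ... | inj₂ p    | inj₁ refl = ⊥-elim (<⇒≢ (s≤pre p) (sym e))
    ... | inj₂ p    | inj₂ q    = pre-inj p q e

    nested′ : ∀ {x y} → x ∈ S → y ∈ S → Adj G x y → pre (lab x) ≤ pre (lab y) → pre (lab y) ≤ end (lab x)
    nested′ x∈ y∈ xy x≤y with view x∈ | view y∈
    ... | inj₁ refl | inj₁ refl = <⇒≤ s<t
    ... | inj₁ refl | inj₂ q    = <⇒≤ (≤-<-trans (pre≤end q) (end<t q))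
    ... | inj₂ p    | inj₁ refl = ⊥-elim (<⇒≱ (s≤pre p) x≤y)
    ... | inj₂ p    | inj₂ q    = nested p q xy x≤y

    coloured′ : ∀ {a x y} → x ∈ S → y ∈ S → (a ∈ S → pre (lab a) < pre (lab x)) →
                pre (lab x) < pre (lab y) → pre (lab y) ≤ end (lab x) → Adj G a y → col (lab x) ≢ col (lab a)
    coloured′ {a} x∈ y∈ a<x x<y y≤x ay with view x∈ | view y∈
    ... | _         | inj₁ refl = ⊥-elim (<⇒≱ x<y ([ (λ { refl → ≤-refl }) , <⇒≤ ∘ s≤pre ]′ (view x∈)))
    ... | inj₂ p    | inj₂ q    = coloured p q (a<x ∘ p─q⊆p S ⁅ v ⁆) x<y y≤x ay
    ... | inj₁ refl | inj₂ q    = new a∉S y∈ (λ { refl → <-irrefl refl x<y }) ay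
      where
      a∉S : a ∉ S
      a∉S a∈ with view a∈
      ... | inj₁ refl = <-irrefl refl (a<x a∈)
      ... | inj₂ r    = <-asym (a<x a∈) (s≤pre r)

  finish : ∀ {c S} → Elim c S → ℕ → ℕ
  finish (empty _)          s = s
  -- The root's right end is `finish E (suc s)` and `end<t` is strict, hence the outer `suc`.
  finish (root _ _ _ _ _ E) s = suc (finish E (suc s))
  finish (split _ _ _ E F)  s = finish F (finish E s)

  s≤finish : ∀ {c S} (E : Elim c S) s → s ≤ finish E s
  s≤finish (empty _)          s = ≤-refl
  s≤finish (root _ _ _ _ _ E) s = m≤n⇒m≤1+n (<⇒≤ (s≤finish E (suc s)))
  s≤finish (split _ _ _ E F)  s = ≤-trans (s≤finish E s) (s≤finish F _)

  -- A root is coloured before its subtree, against the colours that `lab` already gives to its bag.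
  -- The last component ensures that labels outside `S` survive the later steps.
  layout : ∀ {c S} (E : Elim c S) (lab : Fin n → Label c) s →
           ∃[ lab′ ] (Layout S lab′ s (finish E s) × (∀ {x} → x ∉ S → lab′ x ≡ lab x))
  layout (empty none) lab s = lab , ℓ , λ _ → refl
    where
    ℓ = record
      { s≤pre    = λ x∈ → ⊥-elim (none (_ , x∈))
      ; pre≤end  = λ x∈ → ⊥-elim (none (_ , x∈))
      ; end<t    = λ x∈ → ⊥-elim (none (_ , x∈))
      ; pre-inj  = λ x∈ → ⊥-elim (none (_ , x∈))
      ; nested   = λ x∈ → ⊥-elim (none (_ , x∈))
      ; coloured = λ x∈ → ⊥-elim (none (_ , x∈))
      }
  layout {S = S} (root v v∈S bag bag<c dom E) lab s =
    lab₂ , Layout-root (cong pre at-v) (cong end at-v) (s≤finish E (suc s)) new ℓ , off-S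
    where
    k∉ = fresh (map (col ∘ lab) bag) (subst (_< _) (sym (length-map (col ∘ lab) bag)) bag<c)
    lv : Label _
    lv = label s (finish E (suc s)) (proj₁ k∉)
    lab₁ : Fin n → Label _
    lab₁ = updated v lv lab
    ih = layout E lab₁ (suc s)
    lab₂ = proj₁ ih
    ℓ = proj₁ (proj₂ ih)
    off = proj₂ (proj₂ ih)

    at-v : lab₂ v ≡ lv
    at-v = trans (off x∉p-x) (updated-at v lv lab)

    off-S : ∀ {x} → x ∉ S → lab₂ x ≡ lab x
    off-S x∉S = trans (off (x∉S ∘ p─q⊆p S ⁅ v ⁆)) (updated-off lv lab λ { refl → x∉S v∈S })

    new : ∀ {a x} → a ∉ S → x ∈ S → x ≢ v → Adj G a x → col (lab₂ v) ≢ col (lab₂ a)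
    new a∉ x∈ x≢v ax e = proj₂ k∉ (subst (_∈ˡ _) (trans (cong col (sym (off-S a∉))) (trans (sym e) (cong col at-v)))
                                          (∈-map⁺ (col ∘ lab) (dom a∉ x∈ x≢v ax)))
  layout {S = S} (split U U⊆S no-edge E F) lab s
    with lab₁ , ℓ₁ , off₁ ← layout E lab s
    with lab₂ , ℓ₂ , off₂ ← layout F lab₁ (finish E s) =
    lab₂ ,
    Layout-split U⊆S no-edge (s≤finish E s) (s≤finish F _)
      (Layout-resp (λ x∈ → sym (off₂ (x∈p─q⇒x∉q x∈))) (λ x∈ ax → sym (off₂ λ a∈ → no-edge x∈ a∈ (symm G ax))) ℓ₁) ℓ₂ ,
    λ x∉ → trans (off₂ (x∉ ∘ U⊆S)) (off₁ (x∉ ∘ p─q⊆p S U))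

  -- From a layout to boxes.

  module _ {c t} (lab : Fin n → Label c) (ℓ : Layout full lab 0 t) where
    open Layout ℓ

    private
      π ε : Fin n → ℕ
      π x = pre (lab x)
      ε x = end (lab x)
      χ : Fin n → Fin c
      χ x = col (lab x)

    -- By coloured, v has at most one neighbour of colour k among its ancestors.
    back : Fin c → Fin n → ℕ
    back k v with any? (λ u → adj? G u v ×-dec π u <? π v ×-dec χ u ≟ᶠ k)
    ... | yes (u , _) = π u
    ... | no  _       = π v

    back-cases : ∀ k v → back k v ≡ π v ⊎ ∃[ u ] (Adj G u v × π u < π v × χ u ≡ k × back k v ≡ π u)
    back-cases k v with any? (λ u → adj? G u v ×-dec π u <? π v ×-dec χ u ≟ᶠ k)
    ... | yes (u , uv , u<v , e) = inj₂ (u , uv , u<v , e , refl)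
    ... | no  _                  = inj₁ refl

    back≤π : ∀ k v → back k v ≤ π v
    back≤π k v with back-cases k v
    ... | inj₁ e                       = ≤-reflexive e
    ... | inj₂ (_ , _ , u<v , _ , e) rewrite e = <⇒≤ u<v

    back-neighbour : ∀ {u v} → Adj G u v → π u < π v → back (χ u) v ≤ π u
    back-neighbour {u} {v} uv u<v with any? (λ w → adj? G w v ×-dec π w <? π v ×-dec χ w ≟ᶠ χ u)
    ... | no none = ⊥-elim (none (u , uv , u<v , refl))
    -- If the chosen `w` came after `u`, it would be an ancestor of `v` below which `u` has the
    -- neighbour `v`, so its colour would differ from that of `u`.
    ... | yes (w , wv , w<v , e) = ≮⇒≥ λ u<w →
            coloured ∈⊤ ∈⊤ (λ _ → u<w) w<v (nested ∈⊤ ∈⊤ wv (<⇒≤ w<v)) uv e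

    lo hi : Fin (suc c) → Fin n → ℕ
    lo zero    = π
    lo (suc k) = back k
    hi zero    = ε
    hi (suc k) v with χ v ≟ᶠ k
    ... | yes _ = π v
    ... | no  _ = t

    π<t : ∀ v → π v < t
    π<t v = ≤-<-trans (pre≤end ∈⊤) (end<t ∈⊤)

    π≤hi : ∀ i v → π v ≤ hi i v
    π≤hi zero    v = pre≤end ∈⊤
    π≤hi (suc k) v with χ v ≟ᶠ k
    ... | yes _ = ≤-refl
    ... | no  _ = <⇒≤ (π<t v)

    lo≤π : ∀ i v → lo i v ≤ π v
    lo≤π zero    v = ≤-refl
    lo≤π (suc k) v = back≤π k v

    meet : ∀ {u v} → Adj G u v → ∀ i → lo i u ≤ hi i v
    meet {u} {v} uv i with ≤-<-connex (π u) (π v)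
    ... | inj₁ u≤v = ≤-trans (lo≤π i u) (≤-trans u≤v (π≤hi i v))
    meet {u} {v} uv zero    | inj₂ v<u = nested ∈⊤ ∈⊤ (symm G uv) (<⇒≤ v<u)
    meet {u} {v} uv (suc k) | inj₂ v<u with χ v ≟ᶠ k
    ... | yes refl = back-neighbour (symm G uv) v<u
    ... | no  _    = ≤-trans (back≤π k u) (<⇒≤ (π<t u))

    hi-own : ∀ v → hi (suc (χ v)) v ≡ π v
    hi-own v with χ v ≟ᶠ χ v
    ... | yes _ = refl
    ... | no ¬e = ⊥-elim (¬e refl)

    -- Dimension zero works if the subtree interval of `u` ends before `v`. Otherwise, in the
    -- dimension of the colour of `u`, `u` ends at its own number. If `v` starts at a neighbour `w`
    -- there, then `w` is not `u`, and `w` before `u` would violate `coloured`.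
    separate-< : ∀ {u v} → π u < π v → ¬ Adj G u v → ∃[ i ] hi i u < lo i v
    separate-< {u} {v} u<v ¬uv with ε u <? π v
    ... | yes ε<π = zero , ε<π
    ... | no  ε≮π = suc (χ u) , subst (_< back (χ u) v) (sym (hi-own u)) π<back
      where
      π<back : π u < back (χ u) v
      π<back with back-cases (χ u) v
      ... | inj₁ e rewrite e = u<v
      ... | inj₂ (w , wv , w<v , χw≡χu , e) rewrite e with <-cmp (π u) (π w)
      ...   | tri< u<w _ _ = u<w
      ...   | tri≈ _ u≡w _ = ⊥-elim (¬uv (subst (λ x → Adj G x v) (sym (pre-inj ∈⊤ ∈⊤ u≡w)) wv))
      ...   | tri> _ _ w<u = ⊥-elim (coloured ∈⊤ ∈⊤ (λ _ → w<u) u<v (≮⇒≥ ε≮π) wv (sym χw≡χu))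

    separate : ∀ {u v} → u ≢ v → ¬ Adj G u v → ∃[ i ] (hi i u < lo i v ⊎ hi i v < lo i u)
    separate {u} {v} u≢v ¬uv with <-cmp (π u) (π v)
    ... | tri< u<v _ _ = let i , d = separate-< u<v ¬uv in i , inj₁ d
    ... | tri≈ _ u≡v _ = ⊥-elim (u≢v (pre-inj ∈⊤ ∈⊤ u≡v))
    ... | tri> _ _ v<u = let i , d = separate-< v<u (¬uv ∘ symm G) in i , inj₂ d

    layout⇒boxes : BoxRepresentation G (suc c)
    layout⇒boxes = fromIntervals lo hi (λ i v → ≤-trans (lo≤π i v) (π≤hi i v)) meet separate

  elim⇒boxes : ∀ {c} → 1 ≤ c → Elim c full → BoxRepresentation G (suc c)
  -- `1 ≤ c` supplies the colour of the initial labels, all of which get overwritten.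
  elim⇒boxes (s≤s _) E = let lab , ℓ , _ = layout E (λ _ → label 0 0 zero) 0 in layout⇒boxes lab ℓ

  -- Induced paths and the cycles they close.

  -- The path leads from `x` to `y` through `x ∷ xs`; the parameter is its last vertex, since paths
  -- grow at the front.
  data InducedPath (y : Fin n) : Fin n → List (Fin n) → Set where
    stop : InducedPath y y []
    step : ∀ {x z zs} → Adj G x z → (∀ {u} → u ∈ˡ zs → ¬ Adj G x u × x ≢ u) →
           InducedPath y z zs → InducedPath y x (z ∷ zs)

  adj⇒≢ : ∀ {u v} → Adj G u v → u ≢ v
  adj⇒≢ uv u≡v = irrefl G u≡v uv

  head∉tail : ∀ {y x xs} → InducedPath y x xs → x ∉ˡ xs
  head∉tail (step xz far P) (here x≡z) = adj⇒≢ xz x≡z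
  head∉tail (step xz far P) (there x∈) = proj₂ (far x∈) refl

  last∈ : ∀ {y x xs} → InducedPath y x xs → y ∈ˡ x ∷ xs
  last∈ stop         = here refl
  last∈ (step _ _ P) = there (last∈ P)

  last∈tail : ∀ {y x z zs} → InducedPath y x (z ∷ zs) → y ∈ˡ z ∷ zs
  last∈tail (step _ _ P) = last∈ P

  lookup-injective : ∀ {y x xs} → InducedPath y x xs → ∀ i j → lookup (x ∷ xs) i ≡ lookup (x ∷ xs) j → i ≡ j
  lookup-injective P            zero    zero    _ = refl
  lookup-injective P@(step _ _ _) zero    (suc j) e = ⊥-elim (head∉tail P (subst (_∈ˡ _) (sym e) (∈-lookup j)))
  lookup-injective P@(step _ _ _) (suc i) zero    e = ⊥-elim (head∉tail P (subst (_∈ˡ _) e (∈-lookup i)))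
  lookup-injective (step _ _ P) (suc i) (suc j) e = cong suc (lookup-injective P i j e)

  lookup-last : ∀ {y x xs} → InducedPath y x xs → lookup (x ∷ xs) (lastFin (length xs)) ≡ y
  lookup-last stop         = refl
  lookup-last (step _ _ P) = lookup-last P

  consecutive⇒adj : ∀ {y x xs} → InducedPath y x xs → ∀ i j → suc (toℕ i) ≡ toℕ j →
                    Adj G (lookup (x ∷ xs) i) (lookup (x ∷ xs) j)
  consecutive⇒adj (step xz _ _) zero    (suc zero)    _ = xz
  consecutive⇒adj (step _ _ P)  (suc i) (suc j)       e = consecutive⇒adj P i j (suc-injective e)

  adj⇒consecutive : ∀ {y x xs} → InducedPath y x xs → ∀ i j → Adj G (lookup (x ∷ xs) i) (lookup (x ∷ xs) j) →
                    suc (toℕ i) ≡ toℕ j ⊎ suc (toℕ j) ≡ toℕ i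
  adj⇒consecutive P              zero          zero          a = ⊥-elim (irrefl G refl a)
  adj⇒consecutive (step _ _ _)   zero          (suc zero)    a = inj₁ refl
  adj⇒consecutive (step _ far _) zero          (suc (suc j)) a = ⊥-elim (proj₁ (far (∈-lookup j)) a)
  adj⇒consecutive (step _ _ _)   (suc zero)    zero          a = inj₂ refl
  adj⇒consecutive (step _ far _) (suc (suc i)) zero          a = ⊥-elim (proj₁ (far (∈-lookup i)) (symm G a))
  adj⇒consecutive (step _ _ P)   (suc i)       (suc j)       a with adj⇒consecutive P i j a
  ... | inj₁ e = inj₁ (cong suc e)
  ... | inj₂ e = inj₂ (cong suc e)

  -- `c` takes position 0, so its two edges are the first step and the wrap-around of the cycle.
  close : ∀ {c x y z zs} → InducedPath y x (z ∷ zs) → Adj G c x → Adj G c y → c ∉ˡ x ∷ z ∷ zs →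
          (∀ {u} → u ∈ˡ x ∷ z ∷ zs → Adj G c u → u ≡ x ⊎ u ≡ y) → InducedCycle G (3 + length zs)
  close {c} {x} {y} {z} {zs} P cx cy c∉ only = cycle , chordless
    where
    L = x ∷ z ∷ zs

    at-last : ∀ {j : Fin (length L)} → suc (toℕ j) ≡ length L → lookup L j ≡ y
    at-last {j} e = trans (cong (lookup L) (toℕ-injective (trans (suc-injective e) (sym (toℕ-fromℕ _))))) (lookup-last P)

    distinct : ∀ {i j} → lookup (c ∷ L) i ≡ lookup (c ∷ L) j → i ≡ j
    distinct {zero}  {zero}  e = refl
    distinct {zero}  {suc j} e = ⊥-elim (c∉ (subst (_∈ˡ L) (sym e) (∈-lookup j)))
    distinct {suc i} {zero}  e = ⊥-elim (c∉ (subst (_∈ˡ L) e (∈-lookup i)))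
    distinct {suc i} {suc j} e = cong suc (lookup-injective P i j e)

    edge : ∀ i j → Next i j → Adj G (lookup (c ∷ L) i) (lookup (c ∷ L) j)
    edge zero    (suc zero) (inj₁ e)        = cx
    edge (suc i) (suc j)    (inj₁ e)        = consecutive⇒adj P i j (suc-injective e)
    edge (suc i) zero       (inj₂ (e , _))  = subst (λ v → Adj G v c) (sym (at-last (suc-injective e))) (symm G cy)

    cycle : Cycle G (3 + length zs)
    cycle = record { ℓ≥3 = s≤s (s≤s (s≤s z≤n)) ; vertex = lookup (c ∷ L) ; distinct = distinct ; edge = edge }

    spoke : ∀ j → ¬ Next (zero {suc (length L) ∸ 1}) (suc j) → ¬ Next (suc j) zero → ¬ Adj G c (lookup L j)
    spoke j ¬n ¬n′ a with only (∈-lookup j) a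
    ... | inj₁ e with lookup-injective P j zero e
    ...   | refl = ¬n (inj₁ refl)
    spoke j ¬n ¬n′ a | inj₂ e with lookup-injective P j (lastFin _) (trans e (sym (lookup-last P)))
    ...   | refl = ¬n′ (inj₂ (cong (λ k → suc (suc (suc k))) (toℕ-fromℕ (length zs)) , refl))

    chordless : Chordless cycle
    chordless zero    zero    ¬n ¬n′ a = irrefl G refl a
    chordless zero    (suc j) ¬n ¬n′ a = spoke j ¬n ¬n′ a
    chordless (suc i) zero    ¬n ¬n′ a = spoke i ¬n′ ¬n (symm G a)
    chordless (suc i) (suc j) ¬n ¬n′ a with adj⇒consecutive P i j a
    ... | inj₁ e = ¬n (inj₁ (cong suc e))
    ... | inj₂ e = ¬n′ (inj₁ (cong suc e))

  append : ∀ {q p T y z Q} → InducedPath q p T → InducedPath y z Q → Adj G q z →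
           (∀ {u v} → u ∈ˡ p ∷ T → v ∈ˡ z ∷ Q → u ≢ v) →
           (∀ {u v} → u ∈ˡ p ∷ T → v ∈ˡ z ∷ Q → Adj G u v → u ≡ q × v ≡ z) →
           InducedPath y p (T ++ z ∷ Q)
  append stop R qz disj only =
    step qz (λ v∈ → (λ qv → head∉tail R (subst (_∈ˡ _) (proj₂ (only (here refl) (there v∈) qv)) v∈))
                  , disj (here refl) (there v∈)) R
  append {z = z} {Q} P@(step {x = p} {zs = zs} pt far P′) R qz disj only =
    step pt far′ (append P′ R qz (disj ∘ there) (only ∘ there))
    where
    far′ : ∀ {u} → u ∈ˡ zs ++ z ∷ Q → ¬ Adj G p u × p ≢ u
    far′ u∈ with ∈-++⁻ zs u∈
    ... | inj₁ u∈zs = far u∈zs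
    ... | inj₂ u∈R  = (λ pu → head∉tail P (subst (_∈ˡ _) (sym (proj₁ (only (here refl) u∈R pu))) (last∈ P′)))
                    , disj (here refl) u∈R

  dropLast : ∀ {q p t T} → InducedPath q p (t ∷ T) →
             ∃[ q′ ] ∃[ T′ ] (InducedPath q′ p T′ × length T′ ≤ length T × (∀ {u} → u ∈ˡ T′ → u ∈ˡ t ∷ T) ×
                              (∀ {u} → u ∈ˡ t ∷ T → u ≢ q → u ∈ˡ T′))
  dropLast (step pt far stop) = _ , [] , stop , z≤n , (λ ()) , λ { (here u≡q) u≢q → ⊥-elim (u≢q u≡q) }
  dropLast {t = t} {T = s ∷ S} (step pt far P@(step _ _ _)) with q′ , T′ , P′ , len , sub , sup ← dropLast P =
    q′ , t ∷ T′ , step pt (far ∘ sub) P′ , s≤s len ,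
    (λ { (here e) → here e ; (there u∈) → there (sub u∈) }) ,
    λ { (here e) _ → here e ; (there u∈) u≢q → there (sup u∈ u≢q) }

  -- `x` is joined to its last neighbour on the path, and everything before that neighbour is
  -- dropped.
  shortcut : ∀ {x y w ws} → InducedPath y w ws → x ∉ˡ w ∷ ws → Any (Adj G x) (w ∷ ws) →
             ∃[ z ] ∃[ zs ] (InducedPath y x (z ∷ zs) × (∀ {u} → u ∈ˡ z ∷ zs → u ∈ˡ w ∷ ws))
  shortcut stop x∉ (here xw) = _ , [] , step xw (λ ()) stop , λ u∈ → u∈
  shortcut {x} {w = w} {ws} P@(step _ _ P′) x∉ adj with Any.any? (adj? G x) ws
  ... | yes adj′ = let z , zs , Q , sub = shortcut P′ (x∉ ∘ there) adj′ in z , zs , Q , there ∘ sub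
  shortcut {x} {w = w} {ws} P@(step _ _ P′) x∉ (here xw)   | no ¬adj =
    w , ws , step xw (λ u∈ → (λ xu → ¬adj (lose u∈ xu)) , λ { refl → x∉ (there u∈) }) P , λ u∈ → u∈
  shortcut P@(step _ _ P′) x∉ (there adj) | no ¬adj = ⊥-elim (¬adj adj)

  -- Components attached to a vertex.

  -- The interior of the path avoids the set U of vertices not reached so far, so
  -- the path can be prolonged by any vertex of U.
  Reached : (T U : Subset n) (y r : Fin n) → Set
  Reached T U y r = ∃[ xs ] (InducedPath y r xs × (∀ {u} → u ∈ˡ r ∷ xs → u ∈ T × u ∉ U ⊎ u ≡ y))

  -- For `y ∉ T`, `U` is the union of the components of `G[T]` without a neighbour of `y`.
  record Unreachable (T : Subset n) (y : Fin n) (U : Subset n) : Set where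
    field
      U⊆T     : U ⊆ T
      reached : ∀ {r} → r ∈ T → r ∉ U → Reached T U y r
      ¬adj-y  : ∀ {x} → x ∈ U → ¬ Adj G x y
      ¬adj-r  : ∀ {x r} → x ∈ U → r ∈ T → r ∉ U → ¬ Adj G x r

  -- A vertex of `U` adjacent to `y` or to a reached vertex is moved out, and `shortcut` makes its
  -- path induced. Older paths avoid the smaller set as well.
  reach : ∀ {T y U} → Acc _⊂_ U → y ∉ T → U ⊆ T → (∀ {r} → r ∈ T → r ∉ U → Reached T U y r) → ∃ (Unreachable T y)
  reach {T} {y} {U} (acc rs) y∉T U⊆T reached
    with any? (λ x → x ∈? U ×-dec (adj? G x y ⊎-dec any? (λ r → r ∈? T ×-dec ¬? (r ∈? U) ×-dec adj? G x r)))
  ... | no none = U , record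
    { U⊆T     = U⊆T
    ; reached = reached
    ; ¬adj-y  = λ x∈ xy → none (_ , x∈ , inj₁ xy)
    ; ¬adj-r  = λ x∈ r∈ r∉ xr → none (_ , x∈ , inj₂ (_ , r∈ , r∉ , xr))
    }
  ... | yes (x , x∈U , adj) = reach (rs (x∈p⇒p-x⊂p x∈U)) y∉T (U⊆T ∘ p─q⊆p U ⁅ x ⁆) reached′
    where
    weaken : ∀ {u} → u ∈ T × u ∉ U ⊎ u ≡ y → u ∈ T × u ∉ U - x ⊎ u ≡ y
    weaken (inj₁ (u∈ , u∉)) = inj₁ (u∈ , u∉ ∘ p─q⊆p U ⁅ x ⁆)
    weaken (inj₂ e)         = inj₂ e

    extend : ∀ {w} → Adj G x w → Reached T U y w → Reached T (U - x) y x
    extend xw (ws , P , within) =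
      let z , zs , Q , sub = shortcut P (λ x∈ → [ (λ (_ , x∉U) → x∉U x∈U) , (λ { refl → y∉T (U⊆T x∈U) }) ]′ (within x∈)) (here xw)
      in z ∷ zs , Q , λ { (here refl) → inj₁ (U⊆T x∈U , x∉p-x) ; (there u∈) → weaken (within (sub u∈)) }

    new : Reached T (U - x) y x
    new = [ (λ xy → extend xy ([] , stop , λ { (here e) → inj₂ e }))
          , (λ (_ , r∈ , r∉ , xr) → extend xr (reached r∈ r∉)) ]′ adj

    reached′ : ∀ {r} → r ∈ T → r ∉ U - x → Reached T (U - x) y r
    reached′ {r} r∈ r∉ with r ≟ᶠ x
    ... | yes refl = new
    ... | no  r≢x  = let xs , P , within = reached r∈ (λ r∈U → r∉ (x∈p∧x≢y⇒x∈p-y r∈U r≢x)) in xs , P , weaken ∘ within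

  unreachable : ∀ {T y} → y ∉ T → ∃ (Unreachable T y)
  unreachable {T} y∉T = reach (⊂-wellFounded T) y∉T (λ x∈ → x∈) λ r∈ r∉ → ⊥-elim (r∉ r∈)

  -- A long induced cycle or an elimination forest.

  LongCycle : ℕ → Set
  LongCycle k = ∃[ ℓ ] (InducedCycle G ℓ × k ≤ ℓ)

  Boundary : Subset n → (Fin n → Set) → Set
  Boundary S D = ∀ {a x} → a ∉ S → x ∈ S → Adj G a x → D a

  Outcome : ℕ → ℕ → Subset n → Set
  Outcome k c S = LongCycle k ⊎ Elim c S

  splitOutcome : ∀ {k c S} U → U ⊆ S → (∀ {a x} → a ∈ S ─ U → x ∈ U → ¬ Adj G a x) →
                Outcome k c (S ─ U) → Outcome k c U → Outcome k c S
  splitOutcome U U⊆S no-edge (inj₁ C) _        = inj₁ C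
  splitOutcome U U⊆S no-edge (inj₂ E) (inj₁ C) = inj₁ C
  splitOutcome U U⊆S no-edge (inj₂ E) (inj₂ F) = inj₂ (split U U⊆S no-edge E F)

  -- Among the neighbours of `c` on the path other than `y`, the one nearest to `y` closes an
  -- induced cycle.
  close-or-far : ∀ {c y x xs} → InducedPath y x xs → c ∉ˡ x ∷ xs → Adj G c y →
                 LongCycle 3 ⊎ (∀ {u} → u ∈ˡ x ∷ xs → Adj G c u → u ≡ y)
  close-or-far stop c∉ cy = inj₂ λ { (here e) _ → e }
  close-or-far {c} {x = x} P@(step _ _ P′) c∉ cy with close-or-far P′ (c∉ ∘ there) cy | adj? G c x
  ... | inj₁ C   | _      = inj₁ C
  ... | inj₂ far | yes cx = inj₁ (_ , close P cx cy c∉ (λ { (here e) _ → inj₁ e ; (there u∈) cu → inj₂ (far u∈ cu) }) , m≤m+n 3 _)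
  ... | inj₂ far | no ¬cx = inj₂ λ { (here refl) cu → ⊥-elim (¬cx cu) ; (there u∈) cu → far u∈ cu }

  -- Graphs without induced cycles: one colour.

  mutual
    forest∅ : ∀ {S} → Acc _⊂_ S → Boundary S (λ _ → ⊥) → Outcome 3 1 S
    forest∅ {S} (acc rs) bd with any? (_∈? S)
    ... | no none       = inj₂ (empty none)
    ... | yes (v , v∈S) = map₂ (root v v∈S [] (s≤s z≤n) λ a∉ x∈ _ ax → ⊥-elim (bd a∉ x∈ ax))
                               (forest (rs (x∈p⇒p-x⊂p v∈S)) x∉p-x bd′)
      where
      bd′ : Boundary (S - v) (_≡ v)
      bd′ {a} a∉ x∈ ax with a ≟ᶠ v
      ... | yes a≡v = a≡v
      ... | no  a≢v = ⊥-elim (bd (λ a∈ → a∉ (x∈p∧x≢y⇒x∈p-y a∈ a≢v)) (p─q⊆p S ⁅ v ⁆ x∈) ax)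

    -- Let `v` be a neighbour of `p` in `S`. The components of `G[S - v]` touching `v` go below `v`;
    -- the others form `U` and stay attached to `p` alone. A second neighbour of `p` in the former
    -- would close an induced cycle through `p` and `v`, so they are attached to `v` alone and the
    -- bag of `v` is empty.
    forest : ∀ {S p} → Acc _⊂_ S → p ∉ S → Boundary S (_≡ p) → Outcome 3 1 S
    forest {S} {p} ac@(acc rs) p∉S bd with any? (λ v → v ∈? S ×-dec adj? G p v)
    ... | no none = forest∅ ac λ { a∉ x∈ ax → none (_ , x∈ , subst (λ w → Adj G w _) (bd a∉ x∈ ax) ax) }
    ... | yes (v , v∈S , pv) with unreachable {S - v} {v} x∉p-x
    ... | U , unr with any? (λ r → r ∈? S - v ×-dec ¬? (r ∈? U) ×-dec adj? G p r)
    ... | yes (r , r∈ , r∉ , pr) = found (close-or-far P p∉P pv)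
      where
      open Unreachable unr
      P : InducedPath v r _
      P = proj₁ (proj₂ (reached r∈ r∉))
      p∉P : p ∉ˡ r ∷ _
      p∉P p∈ with proj₂ (proj₂ (reached r∈ r∉)) p∈
      ... | inj₁ (p∈S-v , _) = p∉S (p─q⊆p S ⁅ v ⁆ p∈S-v)
      ... | inj₂ refl        = p∉S v∈S
      found : LongCycle 3 ⊎ (∀ {u} → u ∈ˡ r ∷ _ → Adj G p u → u ≡ v) → Outcome 3 1 S
      found (inj₁ C)   = inj₁ C
      found (inj₂ far) with refl ← far (here refl) pr = ⊥-elim (x∉p-x r∈)
    ... | no none = splitOutcome U U⊆S no-edge
        (map₂ (root v v∈S─U [] (s≤s z≤n) (λ a∉ x∈ x≢v ax → ⊥-elim (a∉
                (subst (_∈ S ─ U) (sym (bd₁ (λ a∈ → a∉ (p─q⊆p _ ⁅ v ⁆ a∈)) (x∈p∧x≢y⇒x∈p-y x∈ x≢v) ax)) v∈S─U))))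
          (forest (rs small₁) x∉p-x bd₁))
        (forest (rs (U⊆S , v , v∈S , v∉U)) (p∉S ∘ U⊆S) bd₂)
      where
      open Unreachable unr
      U⊆S : U ⊆ S
      U⊆S = p─q⊆p S ⁅ v ⁆ ∘ U⊆T
      v∉U : v ∉ U
      v∉U = x∉p-x ∘ U⊆T
      v∈S─U : v ∈ S ─ U
      v∈S─U = x∈p∧x∉q⇒x∈p─q v∈S v∉U
      small₁ : S ─ U - v ⊂ S
      small₁ = p─q⊆p S U ∘ p─q⊆p (S ─ U) ⁅ v ⁆ , v , v∈S , x∉p-x
      no-edge : ∀ {a x} → a ∈ S ─ U → x ∈ U → ¬ Adj G a x
      no-edge {a} a∈ x∈U ax with a ≟ᶠ v
      ... | yes refl = ¬adj-y x∈U (symm G ax)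
      ... | no  a≢v  = ¬adj-r x∈U (x∈p∧x≢y⇒x∈p-y (p─q⊆p S U a∈) a≢v) (x∈p─q⇒x∉q a∈) (symm G ax)
      bd₁ : Boundary (S ─ U - v) (_≡ v)
      bd₁ {a} {x} a∉ x∈ ax with a ≟ᶠ v | a ∈? S | a ∈? U
      ... | yes a≡v | _       | _       = a≡v
      ... | no  a≢v | yes a∈S | yes a∈U = ⊥-elim (no-edge (p─q⊆p (S ─ U) ⁅ v ⁆ x∈) a∈U (symm G ax))
      ... | no  a≢v | yes a∈S | no  a∉U = ⊥-elim (a∉ (x∈p∧x≢y⇒x∈p-y (x∈p∧x∉q⇒x∈p─q a∈S a∉U) a≢v))
      ... | no  a≢v | no  a∉S | _       = ⊥-elim (none (x , x∈p∧x≢y⇒x∈p-y (p─q⊆p S U x∈S─U) (λ { refl → x∉p-x x∈ })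
                                                 , x∈p─q⇒x∉q x∈S─U , subst (λ w → Adj G w x) (bd a∉S (p─q⊆p S U x∈S─U) ax) ax))
        where x∈S─U = p─q⊆p (S ─ U) ⁅ v ⁆ x∈
      bd₂ : Boundary U (_≡ p)
      bd₂ {a} a∉ x∈ ax with a ∈? S
      ... | yes a∈S = ⊥-elim (no-edge (x∈p∧x∉q⇒x∈p─q a∈S a∉) x∈ ax)
      ... | no  a∉S = bd a∉S (U⊆S x∈) ax

  -- The search guarded by an induced path.

  -- The vertices of `X` in `S` become roots one after another. N(S) stays within `X`, so each takes
  -- the rest of `X` as its bag.
  absorb : ∀ {k c S} → Acc _⊂_ S → (X : List (Fin n)) → length X ≤ c → Boundary S (_∈ˡ X) →
           (∀ {S′} → S′ ⊆ S → (∀ {x} → x ∈ S′ → x ∉ˡ X) → Boundary S′ (_∈ˡ X) → Outcome k c S′) → Outcome k c S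
  absorb {S = S} (acc rs) X X≤c bd continue with any? (λ v → v ∈? S ×-dec DecMembership._∈?_ _≟ᶠ_ v X)
  ... | no none = continue (λ x∈ → x∈) (λ x∈ x∈X → none (_ , x∈ , x∈X)) bd
  ... | yes (v , v∈S , v∈X) =
    map₂ (root v v∈S (filter ≢v? X) (<-≤-trans (filter-notAll ≢v? X (lose v∈X λ v≢v → v≢v refl)) X≤c)
               λ a∉ x∈ _ ax → ∈-filter⁺ ≢v? (bd a∉ x∈ ax) λ { refl → a∉ v∈S })
      (absorb (rs (x∈p⇒p-x⊂p v∈S)) X X≤c bd′ λ S′⊆ → continue (p─q⊆p S ⁅ v ⁆ ∘ S′⊆))
    where
    ≢v? = λ x → ¬? (x ≟ᶠ v)
    bd′ : Boundary (S - v) (_∈ˡ X)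
    bd′ {a} a∉ x∈ ax with a ≟ᶠ v
    ... | yes refl = v∈X
    ... | no  a≢v  = bd (λ a∈ → a∉ (x∈p∧x≢y⇒x∈p-y a∈ a≢v)) (p─q⊆p S ⁅ v ⁆ x∈) ax

  neighbours : Fin n → List (Fin n)
  neighbours v = filter (adj? G v) (allFin n)

  ∈-neighbours⁺ : ∀ {u v} → Adj G u v → u ∈ˡ neighbours v
  ∈-neighbours⁺ uv = ∈-filter⁺ (adj? G _) (∈-allFin _) (symm G uv)

  ∈-neighbours⁻ : ∀ {u v} → u ∈ˡ neighbours v → Adj G u v
  ∈-neighbours⁻ u∈ = symm G (proj₂ (∈-filter⁻ (adj? G _) {xs = allFin n} u∈))

  length-concatMap-≤ : ∀ {Δ} → (∀ v → length (neighbours v) ≤ Δ) → ∀ P → length (concatMap neighbours P) ≤ length P * Δ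
  length-concatMap-≤ deg []      = z≤n
  length-concatMap-≤ deg (p ∷ P) =
    subst (_≤ _) (sym (length-++ (neighbours p))) (+-mono-≤ (deg p) (length-concatMap-≤ deg P))

  module _ {Δ m c : ℕ} (deg : ∀ v → length (neighbours v) ≤ Δ) (2≤m : 2 ≤ m) (1+Δ≤c : 1 + Δ ≤ c) (mΔ≤c : m * Δ ≤ c) where

    -- N(S) lies in N(P), and S is disjoint from N[P].
    record Guarded (S : Subset n) (P : List (Fin n)) : Set where
      field
        P∉S       : ∀ {u} → u ∈ˡ P → u ∉ S
        ¬adj-S    : ∀ {x u} → x ∈ S → u ∈ˡ P → ¬ Adj G x u
        dominated : Boundary S (λ a → Any (Adj G a) P)

    Guarded-⊆ : ∀ {S S′ P} → S′ ⊆ S → (∀ {a x} → a ∈ S → a ∉ S′ → x ∈ S′ → ¬ Adj G a x) → Guarded S P → Guarded S′ P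
    Guarded-⊆ {S} {S′} {P} S′⊆S no-edge g = record
      { P∉S       = λ u∈ → P∉S u∈ ∘ S′⊆S
      ; ¬adj-S    = ¬adj-S ∘ S′⊆S
      ; dominated = dominated′
      }
      where
      open Guarded g
      dominated′ : Boundary S′ (λ a → Any (Adj G a) P)
      dominated′ {a} a∉ x∈ ax with a ∈? S
      ... | yes a∈S = ⊥-elim (no-edge a∈S a∉ x∈ ax)
      ... | no  a∉S = dominated a∉S (S′⊆S x∈) ax

    -- The cycle runs from `p` along the path to `q`, then to `z`, through `S` to `y` and back to
    -- `p`. The path has `2 + length T ≥ m` vertices; `z` and `y` add two.
    longCycle : ∀ {S p q y z t T} → InducedPath q p (t ∷ T) → m ≤ 2 + length T → Guarded S (p ∷ t ∷ T) →
                (∃[ x ] (x ∈ S × Adj G y x)) → Adj G y p → (∀ {u} → u ∈ˡ t ∷ T → ¬ Adj G y u) →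
                (∃[ x ] (x ∈ S × Adj G z x)) → Adj G z q → (∀ {u} → u ∈ˡ p ∷ t ∷ T → Adj G z u → u ≡ q) →
                ∀ {r rs} → InducedPath y z (r ∷ rs) → (∀ {u} → u ∈ˡ r ∷ rs → u ∈ S ⊎ u ≡ y) →
                LongCycle (m + 2)
    longCycle {S} {p} {q} {y} {z} {t} {T} P@(step pt far P′) m≤ g (x , x∈S , yx) yp y-far (x′ , x′∈S , zx′) zq z-far {r} {rs} Q Q⊆ =
      result (append P′ Q (symm G zq) (disj ∘ there) only)
      where
      open Guarded g

      ∉P : ∀ {v w} → w ∈ S → Adj G v w → v ∉ˡ p ∷ t ∷ T
      ∉P w∈S vw v∈P = ¬adj-S w∈S v∈P (symm G vw)

      disj : ∀ {u v} → u ∈ˡ p ∷ t ∷ T → v ∈ˡ z ∷ r ∷ rs → u ≢ v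
      disj u∈ (here refl) refl = ∉P x′∈S zx′ u∈
      disj u∈ (there v∈)  refl with Q⊆ v∈
      ... | inj₁ v∈S  = P∉S u∈ v∈S
      ... | inj₂ refl = ∉P x∈S yx u∈

      only : ∀ {u v} → u ∈ˡ t ∷ T → v ∈ˡ z ∷ r ∷ rs → Adj G u v → u ≡ q × v ≡ z
      only u∈ (here refl) uv = z-far (there u∈) (symm G uv) , refl
      only u∈ (there v∈)  uv with Q⊆ v∈
      ... | inj₁ v∈S  = ⊥-elim (¬adj-S v∈S (there u∈) (symm G uv))
      ... | inj₂ refl = ⊥-elim (y-far u∈ (symm G uv))

      p∉ : p ∉ˡ t ∷ T ++ z ∷ r ∷ rs
      p∉ p∈ with ∈-++⁻ (t ∷ T) p∈
      ... | inj₁ p∈T = head∉tail P p∈T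
      ... | inj₂ p∈Q = disj (here refl) p∈Q refl

      p-far : ∀ {u} → u ∈ˡ t ∷ T ++ z ∷ r ∷ rs → Adj G p u → u ≡ t ⊎ u ≡ y
      p-far u∈ pu with ∈-++⁻ (t ∷ T) u∈
      ... | inj₁ (here e)     = inj₁ e
      ... | inj₁ (there u∈T)  = ⊥-elim (proj₁ (far u∈T) pu)
      ... | inj₂ (here refl)  = ⊥-elim (head∉tail P (subst (_∈ˡ _) (sym (z-far (here refl) (symm G pu))) (last∈ P′)))
      ... | inj₂ (there u∈Q) with Q⊆ u∈Q
      ...   | inj₁ u∈S = ⊥-elim (¬adj-S u∈S (here refl) (symm G pu))
      ...   | inj₂ e   = inj₂ e

      result : InducedPath y t (T ++ z ∷ r ∷ rs) → LongCycle (m + 2)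
      -- `close` wants the list after `t` to be a cons, so it is generalised with the facts about
      -- it; its length rules out `[]`.
      result R with T ++ z ∷ r ∷ rs | length-++ T {z ∷ r ∷ rs} | p∉ | p-far
      ... | w ∷ ws | e | p∉′ | p-far′ = _ , close R pt (symm G yp) p∉′ p-far′ , bound
        where
        bound : m + 2 ≤ 3 + length ws
        bound = ≤-trans (+-monoˡ-≤ 2 m≤) (≤-trans (+-monoʳ-≤ (2 + length T) (m≤m+n 2 (length rs)))
                  (≤-reflexive (cong (2 +_) (sym e))))
      ... | [] | e | _ | _ with () ← trans e (+-suc (length T) _)

    HeadOnly : Subset n → Fin n → List (Fin n) → Fin n → Set
    HeadOnly S p T y = y ∉ S × (∃[ x ] (x ∈ S × Adj G y x)) × Adj G y p × All (λ u → ¬ Adj G y u) T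

    headOnly? : ∀ S p T y → Dec (HeadOnly S p T y)
    headOnly? S p T y = ¬? (y ∈? S) ×-dec any? (λ x → x ∈? S ×-dec adj? G y x) ×-dec adj? G y p
                        ×-dec All.all? (λ u → ¬? (adj? G y u)) T

    headless : ∀ {S p T} → Guarded S (p ∷ T) → ¬ ∃ (HeadOnly S p T) → Boundary S (λ a → Any (Adj G a) T)
    headless {T = T} g none {a} a∉ x∈ ax with Any.any? (adj? G a) T | Guarded.dominated g a∉ x∈ ax
    ... | yes aT | _        = aT
    ... | no ¬aT | there aT = aT
    ... | no ¬aT | here ap  = ⊥-elim (none (a , a∉ , (_ , x∈ , ax) , ap , ¬Any⇒All¬ T ¬aT))

    -- `q` sits at the far end of `P` and cannot be matched off like the head, hence the clause
    -- `u ≡ q`.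
    LastOnly : Subset n → List (Fin n) → Fin n → Fin n → Set
    LastOnly S P q z = z ∉ S × (∃[ x ] (x ∈ S × Adj G z x)) × Adj G z q × All (λ u → ¬ Adj G z u ⊎ u ≡ q) P

    lastOnly? : ∀ S P q z → Dec (LastOnly S P q z)
    lastOnly? S P q z = ¬? (z ∈? S) ×-dec any? (λ x → x ∈? S ×-dec adj? G z x) ×-dec adj? G z q
                        ×-dec All.all? (λ u → ¬? (adj? G z u) ⊎-dec u ≟ᶠ q) P

    lastless : ∀ {S P q} → Guarded S P → ¬ ∃ (LastOnly S P q) →
               Boundary S (λ a → ∃[ u ] (u ∈ˡ P × u ≢ q × Adj G a u))
    lastless {S} {P} {q} g none {a} a∉ x∈ ax with Any.any? (λ u → ¬? (u ≟ᶠ q) ×-dec adj? G a u) P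
    ... | yes other = find other
    ... | no ¬other = ⊥-elim (none (a , a∉ , (_ , x∈ , ax) , aq , All.tabulate only-q))
      where
      only-q : ∀ {u} → u ∈ˡ P → ¬ Adj G a u ⊎ u ≡ q
      only-q {u} u∈ with u ≟ᶠ q
      ... | yes e  = inj₂ e
      ... | no u≢q = inj₁ λ au → ¬other (lose u∈ (u≢q , au))
      aq : Adj G a q
      aq with u , u∈ , au ← find (Guarded.dominated g a∉ x∈ ax) with only-q u∈
      ... | inj₁ ¬au  = ⊥-elim (¬au au)
      ... | inj₂ refl = au

    mutual
      -- With N(S) empty the search restarts from the one-vertex path `v`, with cops on `v` and its
      -- neighbours.
      guard∅ : ∀ {S} → Acc _⊂_ S → Boundary S (λ _ → ⊥) → Outcome (m + 2) c S
      guard∅ {S} ac@(acc rs) bd with any? (_∈? S)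
      ... | no none       = inj₂ (empty none)
      ... | yes (v , v∈S) =
        absorb ac (v ∷ neighbours v) (≤-trans (s≤s (deg v)) 1+Δ≤c) (λ a∉ x∈ ax → ⊥-elim (bd a∉ x∈ ax))
          λ S′⊆S ∉X bd′ → guard (rs (S′⊆S , v , v∈S , λ v∈ → ∉X v∈ (here refl))) 0 z≤n stop (<⇒≤ 2≤m) record
            { P∉S       = λ { (here refl) v∈ → ∉X v∈ (here refl) }
            ; ¬adj-S    = λ { x∈ (here refl) xv → ∉X x∈ (there (∈-neighbours⁺ xv)) }
            ; dominated = λ a∉ x∈ ax → dom ∉X x∈ ax (bd′ a∉ x∈ ax)
            }
        where
        dom : ∀ {S′ a x} → (∀ {x} → x ∈ S′ → x ∉ˡ v ∷ neighbours v) → x ∈ S′ → Adj G a x → a ∈ˡ v ∷ neighbours v →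
              Any (Adj G a) (v ∷ [])
        dom ∉X x∈ ax (here refl) = ⊥-elim (∉X x∈ (there (∈-neighbours⁺ (symm G ax))))
        dom ∉X x∈ ax (there a∈)  = here (∈-neighbours⁻ a∈)

      -- `M` makes the recursion lexicographic: dropping an end keeps `S` and lowers `M`, every
      -- other route back to `guard` shrinks `S`. The path has at most `m` vertices.
      guard : ∀ {S p q T} → Acc _⊂_ S → ∀ M → length T ≤ M → InducedPath q p T → length T < m →
              Guarded S (p ∷ T) → Outcome (m + 2) c S
      guard {S} {p} {q} {T} (acc rs) M T≤M P T<m g with any? (headOnly? S p T) | suc (length T) <? m
      -- The only vertex of the path dominates nothing alone, so N(S) is empty.
      guard {T = []} (acc rs) M T≤M P T<m g | no none | _ =
        guard∅ (acc rs) λ a∉ x∈ ax → ¬Any[] (headless g none a∉ x∈ ax)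
      guard {T = _ ∷ _} (acc rs) (suc M) (s≤s T≤M) (step _ _ P) T<m g | no none | _ =
        guard (acc rs) M T≤M P (<⇒≤ T<m) record
          { P∉S = P∉S ∘ there ; ¬adj-S = λ x∈ → ¬adj-S x∈ ∘ there ; dominated = headless g none }
        where open Guarded g
      guard {S} {p} {q} {T} (acc rs) M T≤M P T<m g | yes (y , y∉S , (x , x∈S , yx) , yp , y-far) | yes 1+T<m =
        -- `P′` has at most `m` vertices, so `m * Δ` cops suffice for its neighbours; these include
        -- `P′`, each of whose vertices has a neighbour on it. Absorbing them removes `x`, a
        -- neighbour of `y`, from `S`.
        absorb (acc rs) X (≤-trans (length-concatMap-≤ deg P′) (≤-trans (*-monoˡ-≤ Δ 1+T<m) mΔ≤c))
          (λ a∉ z∈ az → ∈X (there (dominated a∉ z∈ az)))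
          λ S′⊆S ∉X bd → guard (rs (S′⊆S , x , x∈S , λ x∈ → ∉X x∈ (∈X (here (symm G yx))))) (suc (length T)) ≤-refl
            (step yp (λ u∈ → All.lookup y-far u∈ , λ { refl → ¬adj-S x∈S (there u∈) (symm G yx) }) P) 1+T<m record
            { P∉S       = λ { (here refl) → y∉S ∘ S′⊆S ; (there u∈) → P∉S u∈ ∘ S′⊆S }
            ; ¬adj-S    = λ z∈ u∈ zu → ∉X z∈ (∈X (lose u∈ zu))
            ; dominated = λ a∉ z∈ az → Any.map ∈-neighbours⁻ (∈-concatMap⁻ neighbours {xs = P′} (bd a∉ z∈ az))
            }
        where
        open Guarded g
        P′ X : List (Fin n)
        P′ = y ∷ p ∷ T
        X  = concatMap neighbours P′
        ∈X : ∀ {a} → Any (Adj G a) P′ → a ∈ˡ X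
        ∈X = ∈-concatMap⁺ neighbours ∘ Any.map ∈-neighbours⁺
      guard {T = []} _ _ _ _ _ _ | yes _ | no 1≮m = ⊥-elim (1≮m 2≤m)
      guard {S} {p} {q} {t ∷ T} (acc rs) (suc M) (s≤s T≤M) P T<m g | yes (y , y∉S , (x , x∈S , yx) , yp , y-far) | no 1+T≮m
        with any? (lastOnly? S (p ∷ t ∷ T) q)
      ... | no none with q′ , T′ , P′ , len , sub , sup ← dropLast P =
        guard (acc rs) M (≤-trans len T≤M) P′ (≤-<-trans len (<⇒≤ T<m)) record
          { P∉S       = P∉S ∘ sub′
          ; ¬adj-S    = λ z∈ → ¬adj-S z∈ ∘ sub′
          ; dominated = λ a∉ z∈ az →
              let u , u∈ , u≢q , au = lastless g none a∉ z∈ az in lose (sup′ u∈ u≢q) au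
          }
        where
        open Guarded g
        sub′ : ∀ {u} → u ∈ˡ p ∷ T′ → u ∈ˡ p ∷ t ∷ T
        sub′ (here e)   = here e
        sub′ (there u∈) = there (sub u∈)
        sup′ : ∀ {u} → u ∈ˡ p ∷ t ∷ T → u ≢ q → u ∈ˡ p ∷ T′
        sup′ (here e)   _   = here e
        sup′ (there u∈) u≢q = there (sup u∈ u≢q)
      -- `y` and `z` are private to the two ends. If `w` is reachable from `y` inside `S`, a long
      -- cycle closes; otherwise `U` contains `w` but not `x`, so both parts are proper.
      ... | yes (z , z∉S , (w , w∈S , zw) , zq , z-far) with unreachable {S} {y} y∉S
      ... | U , unr with w ∈? U
      ... | no w∉U =
        let ws , R , within = reached w∈S w∉U
            r , rs , Q , sub = shortcut R (λ z∈ → [ z∉S ∘ proj₁ , z≢y ]′ (within z∈)) (here zw)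
        in inj₁ (longCycle P (≮⇒≥ 1+T≮m) g (x , x∈S , yx) yp (All.lookup y-far) (w , w∈S , zw) zq
                   (λ u∈ zu → [ (λ ¬zu → ⊥-elim (¬zu zu)) , (λ e → e) ]′ (All.lookup z-far u∈))
                   Q (λ u∈ → map₁ proj₁ (within (sub u∈))))
        where
        open Unreachable unr
        z≢y : z ≢ y
        z≢y refl = [ (λ ¬yp → ¬yp yp) , (λ p≡q → head∉tail P (subst (_∈ˡ _) (sym p≡q) (last∈tail P))) ]′ (All.head z-far)
      ... | yes w∈U =
        splitOutcome U U⊆T (λ a∈ u∈ au → ¬adj-r u∈ (p─q⊆p S U a∈) (x∈p─q⇒x∉q a∈) (symm G au))
          (guard (rs (p─q⊆p S U , w , w∈S , λ w∈ → x∈p─q⇒x∉q w∈ w∈U)) (suc M) (s≤s T≤M) P T<m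
            (Guarded-⊆ (p─q⊆p S U) (λ a∈ a∉ u∈ au → ¬adj-r (a∈U a∈ a∉) (p─q⊆p S U u∈) (x∈p─q⇒x∉q u∈) au) g))
          (guard (rs (U⊆T , x , x∈S , λ x∈U → ¬adj-y x∈U (symm G yx))) (suc M) (s≤s T≤M) P T<m
            (Guarded-⊆ U⊆T (λ a∈ a∉ u∈ au → ¬adj-r u∈ a∈ a∉ (symm G au)) g))
        where
        open Unreachable unr
        a∈U : ∀ {a} → a ∈ S → a ∉ S ─ U → a ∈ U
        a∈U {a} a∈ a∉ = decidable-stable (a ∈? U) λ a∉U → a∉ (x∈p∧x∉q⇒x∈p─q a∈ a∉U)

  -- Boxicity and the maximum degree.

  degree≤maxDegree : ∀ v → length (neighbours v) ≤ maxDegree G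
  degree≤maxDegree v = ≤-foldr (∈-allFin v)
    where
    ≤-foldr : ∀ {xs} → v ∈ˡ xs → degree G v ≤ foldr _⊔_ 0 (map (degree G) xs)
    ≤-foldr (here refl) = m≤m⊔n _ _
    ≤-foldr (there v∈)  = ≤-trans (≤-foldr v∈) (m≤n⊔m _ _)

  full-boundary : ∀ {D} → Boundary full D
  full-boundary a∉ _ _ = ⊥-elim (a∉ ∈⊤)

  cycle-or-boxes : LongCycle 3 ⊎ BoxRepresentation G 2
  cycle-or-boxes = map₂ (elim⇒boxes ≤-refl) (forest∅ (⊂-wellFounded full) full-boundary)

  longCycle-or-boxes : ∀ {m} → 2 ≤ m → LongCycle (m + 2) ⊎ BoxRepresentation G (suc (suc (maxDegree G) ⊔ m * maxDegree G))
  longCycle-or-boxes {m} 2≤m = map₂ (elim⇒boxes (≤-trans (s≤s z≤n) 1+Δ≤c))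
    (guard∅ degree≤maxDegree 2≤m 1+Δ≤c (m≤n⊔m (suc (maxDegree G)) (m * maxDegree G)) (⊂-wellFounded full) full-boundary)
    where
    1+Δ≤c : suc (maxDegree G) ≤ suc (maxDegree G) ⊔ m * maxDegree G
    1+Δ≤c = m≤m⊔n (suc (maxDegree G)) (m * maxDegree G)

-- The logarithm and the conclusion.

greatestPower≤bound : ∀ β x k → greatestPower β x k ≤ k
greatestPower≤bound β x zero = z≤n
greatestPower≤bound β x (suc k) with β ^ suc k ≤? x
... | yes _ = ≤-refl
... | no  _ = m≤n⇒m≤1+n (greatestPower≤bound β x k)

-- For `suc m`, multiply `1 + m ≤ 2 ^ m ≤ Δ ^ m` by `Δ`.
m*Δ≤Δ^m : ∀ Δ m → 2 ≤ Δ → m * Δ ≤ Δ ^ m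
m*Δ≤Δ^m Δ zero    2≤Δ = z≤n
m*Δ≤Δ^m Δ (suc m) 2≤Δ = subst (_≤ Δ * Δ ^ m) (*-comm Δ (suc m)) (*-monoʳ-≤ Δ (≤-trans (n<2^n m) (^-monoˡ-≤ m 2≤Δ)))

-- For Δ ≤ 1, where the logarithm is junk, only m ≤ x is available.
colours-bound : ∀ {Δ m x} → 2 ≤ m → m ≤ x → Δ ^ m ≤ x → suc Δ ⊔ m * Δ ≤ x
colours-bound {zero} {m} 2≤m m≤x _ rewrite *-zeroʳ m = ≤-trans (s≤s z≤n) (≤-trans 2≤m m≤x)
colours-bound {suc zero} {m} 2≤m m≤x _ rewrite *-identityʳ m = ⊔-lub (≤-trans 2≤m m≤x) m≤x
colours-bound {Δ@(suc (suc k))} {m} 2≤m _ Δ^m≤x = ⊔-lub (≤-trans 1+Δ≤m*Δ m*Δ≤x) m*Δ≤x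
  where
  m*Δ≤x = ≤-trans (m*Δ≤Δ^m Δ m (s≤s (s≤s z≤n))) Δ^m≤x
  1+Δ≤m*Δ : suc Δ ≤ m * Δ
  1+Δ≤m*Δ = ≤-trans (subst (suc Δ ≤_) (cong (Δ +_) (sym (+-identityʳ Δ))) (+-monoˡ-≤ Δ (s≤s (z≤n {suc k})))) (*-monoˡ-≤ Δ 2≤m)

theorem14 : ∀ {n} (G : Graph n) (Δ b : ℕ) → maxDegree G ≡ Δ → IsBoxicity G b → 3 ≤ b →
    ∃[ ℓ ] (InducedCycle G ℓ × ⌊log[ Δ ] (b ∸ 2) ⌋ + 2 ≤ ℓ)
theorem14 G Δ (suc (suc x)) refl boxicity (s≤s (s≤s 1≤x)) with 2 ≤? ⌊log[ Δ ] x ⌋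
-- The logarithm is at most 1, so any induced cycle is long enough; without one the boxicity would
-- be at most 2.
... | no 2≰m with cycle-or-boxes G
...   | inj₁ (ℓ , C , 3≤ℓ) = ℓ , C , ≤-trans (+-monoˡ-≤ 2 (≤-pred (≰⇒> 2≰m))) 3≤ℓ
...   | inj₂ R = ⊥-elim (<⇒≱ (s≤s (s≤s 1≤x)) (IsBoxicity.minimal boxicity 2 R))
theorem14 G Δ (suc (suc x)) refl boxicity (s≤s (s≤s 1≤x)) | yes 2≤m with longCycle-or-boxes G 2≤m
... | inj₁ C = C
-- At most `x = b - 2` colours would give boxes in at most `b - 1` dimensions.
... | inj₂ R = ⊥-elim (<⇒≱ (s≤s (s≤s c≤x)) (IsBoxicity.minimal boxicity _ R))
  where
  c≤x : suc Δ ⊔ ⌊log[ Δ ] x ⌋ * Δ ≤ x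
  c≤x = colours-bound 2≤m (greatestPower≤bound Δ x x) (^⌊log⌋≤ Δ x 1≤x)
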